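{- Let $(S,\to,\twoheadrightarrow,\hookrightarrow)$ be a two-acyclic factorization system and let $X\subseteq S$ be a closed set. Let $C(X)$ be the set of $\hookrightarrow$-maximal elements of $X$. Then every element of $\operatorname{Cov}(X)$ is a $\twoheadrightarrow$-maximal element of $C(X)$. If $S$ is finite, or more generally if $X$ is finite, then $\operatorname{Cov}(X)$ is precisely the set of $\twoheadrightarrow$-maximal elements of $C(X)$.
   Context: For a binary relation $\to$ on a set $S$ and $X\subseteq S$, put $X^\perp=\{y\in S: x\not\to y\ \forall x\in X\}$ and ${}^\perp X=\{y\in S: y\not\to x\ \forall x\in X\}$. The closure of $X$ is $\overline X={}^\perp(X^\perp)$; $X$ is closed if $\overline X=X$. For a reflexive relation $\to$ on $S$, $\operatorname{Fact}(\to)=(\twoheadrightarrow,\hookrightarrow)$, where $x\twoheadrightarrow y$ iff for all $z$, $y\to z$ implies $x\to z$, and $x\hookrightarrow y$ iff for all $z$, $z\to x$ implies $z\to y$. For preorders $\twoheadrightarrow,\hookrightarrow$ on $S$, $\operatorname{Mult}(\twoheadrightarrow,\hookrightarrow)$ is the relation relating $x$ to $z$ iff there is $y\in S$ with $x\twoheadrightarrow y\hookrightarrow z$. A factorization system is a tuple $(S,\to,\twoheadrightarrow,\hookrightarrow)$ ($S$ possibly infinite) with $\to$ reflexive, $\operatorname{Fact}(\to)=(\twoheadrightarrow,\hookrightarrow)$ and $\operatorname{Mult}(\twoheadrightarrow,\hookrightarrow)=\to$. It is two-acyclic if $x\twoheadrightarrow y\twoheadrightarrow x$ implies $x=y$,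 $x\hookrightarrow y\hookrightarrow x$ implies $x=y$, and $x\twoheadrightarrow y\hookrightarrow x$ implies $x=y$. For $c\in X$, $\operatorname{Del}(X,c)=X\setminus\{x\in X: x\twoheadrightarrow c\}$. For a closed set $X$, $\operatorname{Cov}(X)$ is the set of elements $c\in X$ such that $\operatorname{Del}(X,c)$ is closed and $\overline{\operatorname{Del}(X,c)\cup\{c\}}=X$. Convention: $x\twoheadrightarrow y$ (resp. $x\hookrightarrow y$) is read as "$x$ is greater than or equal to $y$". Thus $c$ is a $\hookrightarrow$-maximal (resp. $\twoheadrightarrow$-maximal) element of a set $A\ni c$ if there is no $c'\in A\setminus\{c\}$ with $c'\hookrightarrow c$ (resp. $c'\twoheadrightarrow c$). -}

module Defs where

open import Data.List.Base using (List)
open import Data.List.Membership.Propositional using () renaming (_∈_ to _∈ₗ_)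
open import Data.Product.Base using (_×_; _,_; ∃; ∃-syntax; proj₁; proj₂)
open import Level using (Level; _⊔_; suc)
open import Relation.Binary.Core using (Rel; _⇔_)
open import Relation.Binary.Definitions using (Reflexive)
open import Relation.Binary.PropositionalEquality.Core using (_≡_)
open import Relation.Nullary.Negation.Core using (¬_)
open import Relation.Unary using (Pred; _∈_; _≐_; _∪_; _∖_; ｛_｝)

private
  variable
    a p ℓ ℓ′ : Level

-- A subset is finite if it is the set of members of some list (repetitions
-- allowed).  A type is finite if its universal subset U is.
Finite : {S : Set a} → Pred S p → Set (a ⊔ p)
Finite {S = S} P = ∃[ xs ] P ≐ (λ (x : S) → x ∈ₗ xs)

-- x ≥ y reads "x is greater than or equal to y".
Maximal : {S : Set a} → Rel S ℓ → Pred S p → Pred S (a ⊔ ℓ ⊔ p)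
Maximal _≥_ A c = c ∈ A × ¬ (∃[ c′ ] c′ ∈ A ∖ ｛ c ｝ × c′ ≥ c)

module Orthogonality {S : Set a} (_⟶_ : Rel S ℓ) where

  infix 8 _^⊥ ⊥^_

  _^⊥ : Pred S p → Pred S (a ⊔ ℓ ⊔ p)
  (X ^⊥) y = ∀ {x} → x ∈ X → ¬ (x ⟶ y)

  ⊥^_ : Pred S p → Pred S (a ⊔ ℓ ⊔ p)
  (⊥^ X) y = ∀ {x} → x ∈ X → ¬ (y ⟶ x)

  closure : Pred S p → Pred S (a ⊔ ℓ ⊔ p)
  closure X = ⊥^ (X ^⊥)

  Closed : Pred S p → Set (a ⊔ ℓ ⊔ p)
  Closed X = closure X ≐ X

Fact : {S : Set a} → Rel S ℓ → Rel S (a ⊔ ℓ) × Rel S (a ⊔ ℓ)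
Fact _⟶_ = (λ x y → ∀ z → y ⟶ z → x ⟶ z) , (λ x y → ∀ z → z ⟶ x → z ⟶ y)

Mult : {S : Set a} → Rel S ℓ → Rel S ℓ′ → Rel S (a ⊔ ℓ ⊔ ℓ′)
Mult _↠_ _↪_ x z = ∃[ y ] x ↠ y × y ↪ z

-- Equality of relations is mutual implication.  That ↠ and ↪ are preorders
-- follows from the fact fields.
record FactorizationSystem (a ℓ₁ ℓ₂ ℓ₃ : Level)
       : Set (suc (a ⊔ ℓ₁ ⊔ ℓ₂ ⊔ ℓ₃)) where
  infix 4 _⟶_ _↠_ _↪_
  field
    S      : Set a
    _⟶_    : Rel S ℓ₁
    _↠_    : Rel S ℓ₂
    _↪_    : Rel S ℓ₃
    ⟶-refl : Reflexive _⟶_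
    fact-↠ : proj₁ (Fact _⟶_) ⇔ _↠_
    fact-↪ : proj₂ (Fact _⟶_) ⇔ _↪_
    mult   : Mult _↠_ _↪_ ⇔ _⟶_

  open Orthogonality _⟶_ public

  record TwoAcyclic : Set (a ⊔ ℓ₂ ⊔ ℓ₃) where
    field
      ↠↠-acyclic : ∀ {x y} → x ↠ y → y ↠ x → x ≡ y
      ↪↪-acyclic : ∀ {x y} → x ↪ y → y ↪ x → x ≡ y
      ↠↪-acyclic : ∀ {x y} → x ↠ y → y ↪ x → x ≡ y

  Del : Pred S p → S → Pred S (p ⊔ ℓ₂)
  Del X c = X ∖ (λ x → x ∈ X × x ↠ c)

  Cov : Pred S p → Pred S (a ⊔ ℓ₁ ⊔ ℓ₂ ⊔ p)
  Cov X c = c ∈ X × Closed (Del X c) × closure (Del X c ∪ ｛ c ｝) ≐ X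

  C : Pred S p → Pred S (a ⊔ ℓ₃ ⊔ p)
  C X = Maximal _↪_ X

{-# OPTIONS --safe #-}
-- For c' ∈ C(X), every d ∈ X with d → c' satisfies d ↠ c': factor d ↠ y ↪ c' and
-- use maximality of c'.  Hence a ↪-maximal c' with c' ↠ c lies in Del(X,c)^⊥.
-- If c ∈ Cov(X), then an element c' of X ∩ Del(X,c)^⊥ satisfies c → c', since
-- c' → c' and X is the closure of Del(X,c) ∪ {c}.  This gives both maximality
-- claims; for the first, c ∉ Del(X,c) yields z ∈ Del(X,c)^⊥ with c ↪ z, so that
-- c' ↪ c implies c' ∈ Del(X,c)^⊥.
--
-- Conversely, if c is ↠-maximal in C(X), then c ∈ Del(X,c)^⊥ makes Del(X,c) closed,
-- and if x → z with x ∈ X, then y → z for some ↪-maximal y ∈ X, which is in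
-- Del(X,c) or equal to c.
--
-- Everything that has to be shown is ¬¬-stable (closed sets are given by negative
-- formulas), so the classical case distinctions are made in front of ⊥.
module Submission where

open import Defs
open import Data.List.Base using (List; []; _∷_)
open import Data.List.Membership.Propositional using () renaming (_∈_ to _∈ₗ_)
open import Data.List.Relation.Unary.Any using (here; there)
open import Data.Product.Base using (_×_; _,_; ∃-syntax; proj₁; proj₂)
open import Data.Sum.Base using (_⊎_; inj₁; inj₂; [_,_]′)
open import Function.Base using (_∘_)
open import Relation.Binary.Core using (Rel)
open import Relation.Binary.Definitions using (Reflexive; Transitive)
open import Relation.Binary.PropositionalEquality.Core using (_≡_; refl; sym; subst)
open import Relation.Nullary.Negation.Core using (¬_)
open import Relation.Unary using (Pred; U; _∈_; _∉_; _⊆_; _≐_; _∪_; ｛_｝)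

module _ {a ℓ} {S : Set a} {_≥_ : Rel S ℓ} (≥-refl : Reflexive _≥_)
         (≥-trans : Transitive _≥_) (≥-antisym : ∀ {x y} → x ≥ y → y ≥ x → x ≡ y)
         {p} {A : Pred S p} where

  -- Testing maximality only against entries of `xs` keeps `A` fixed in the induction on the list.
  -- The double negation replaces deciding whether the head lies in `A` above the current candidate.
  ∃-maximal-within : ∀ (xs : List S) {y} → y ∈ A →
    ¬ ¬ (∃[ m ] m ∈ A × m ≥ y ×
         (∀ {x} → x ∈ₗ xs → x ∈ A → x ≥ m → ¬ ¬ (m ≡ x)))
  ∃-maximal-within []       y∈A k = k (_ , y∈A , ≥-refl , λ ())
  ∃-maximal-within (x ∷ xs) y∈A k =
    ∃-maximal-within xs y∈A λ (m , m∈A , m≥y , max) →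
      k (m , m∈A , m≥y , λ where
        (there x′∈xs) → max x′∈xs
        (here refl) x∈A x≥m _ →
          -- The head `x` supersedes `m`: an entry above `x` is above `m`, hence equal to `m`, and
          -- antisymmetry identifies it with `x`.
          k (x , x∈A , ≥-trans x≥m m≥y , λ where
            (here refl)   _    _     x≢x  → x≢x refl
            (there x′∈xs) x′∈A x′≥x x≢x′ →
              max x′∈xs x′∈A (≥-trans x′≥x x≥m) λ where
                refl → x≢x′ (≥-antisym x≥m x′≥x)))

  ∃-maximal : ∀ {xs} → A ⊆ (_∈ₗ xs) → ∀ {y} → y ∈ A →
    ¬ ¬ (∃[ m ] m ∈ Maximal _≥_ A × m ≥ y)
  ∃-maximal {xs} A⊆xs y∈A k =
    ∃-maximal-within xs y∈A λ (m , m∈A , m≥y , max) →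
      k (m , (m∈A , λ (x , (x∈A , m≢x) , x≥m) → max (A⊆xs x∈A) x∈A x≥m m≢x) , m≥y)

module FactorizationSystemProperties {a ℓ₁ ℓ₂ ℓ₃} (F : FactorizationSystem a ℓ₁ ℓ₂ ℓ₃) where
  open FactorizationSystem F

  ↠-⟶-trans : ∀ {x y z} → x ↠ y → y ⟶ z → x ⟶ z
  ↠-⟶-trans x↠y = proj₂ fact-↠ x↠y _

  ⟶-↪-trans : ∀ {x y z} → x ⟶ y → y ↪ z → x ⟶ z
  ⟶-↪-trans x⟶y y↪z = proj₂ fact-↪ y↪z _ x⟶y

  ↪⇒⟶ : ∀ {x y} → x ↪ y → x ⟶ y
  ↪⇒⟶ = ⟶-↪-trans ⟶-refl

  ↠-refl : Reflexive _↠_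
  ↠-refl = proj₁ fact-↠ λ _ x⟶z → x⟶z

  ↠-trans : Transitive _↠_
  ↠-trans x↠y y↠z = proj₁ fact-↠ λ _ → ↠-⟶-trans x↠y ∘ ↠-⟶-trans y↠z

  ↪-refl : Reflexive _↪_
  ↪-refl = proj₁ fact-↪ λ _ z⟶x → z⟶x

  ↪-trans : Transitive _↪_
  ↪-trans x↪y y↪z = proj₁ fact-↪ λ _ w⟶x → ⟶-↪-trans (⟶-↪-trans w⟶x x↪y) y↪z

  closure-extensive : ∀ {p} {X : Pred S p} → X ⊆ closure X
  closure-extensive x∈X z∈X⊥ = z∈X⊥ x∈X

  closure-mono : ∀ {p q} {X : Pred S p} {Y : Pred S q} → X ⊆ Y → closure X ⊆ closure Y
  closure-mono X⊆Y x∈X̄ z∈Y⊥ = x∈X̄ λ x∈X → z∈Y⊥ (X⊆Y x∈X)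

  ↠-closure : ∀ {p} {X : Pred S p} {x y} → x ↠ y → x ∈ closure X → y ∈ closure X
  ↠-closure x↠y x∈X̄ z∈X⊥ = x∈X̄ z∈X⊥ ∘ ↠-⟶-trans x↠y

  module _ {p} {X : Pred S p} (X-closed : Closed X) where

    ↠-closed : ∀ {x y} → x ↠ y → x ∈ X → y ∈ X
    ↠-closed x↠y = proj₁ X-closed ∘ ↠-closure x↠y ∘ proj₂ X-closed

    ⟶C⇒↠ : ∀ {x c} → x ∈ X → c ∈ C X → x ⟶ c → ¬ ¬ (x ↠ c)
    ⟶C⇒↠ x∈X (_ , c-max) x⟶c ¬x↠c =
      let y , x↠y , y↪c = proj₂ mult x⟶c in
      c-max (y , (↠-closed x↠y x∈X , λ c≡y → ¬x↠c (subst (_ ↠_) (sym c≡y) x↠y)) , y↪c)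

    C⊆Del^⊥ : ∀ {b c} → b ∈ C X → b ↠ c → b ∈ Del X c ^⊥
    C⊆Del^⊥ b∈C b↠c (x∈X , ¬x↠c) x⟶b =
      ⟶C⇒↠ x∈X b∈C x⟶b λ x↠b → ¬x↠c (x∈X , ↠-trans x↠b b↠c)

    ∉Del⇒↠ : ∀ {x c} → x ∈ X → x ∉ Del X c → ¬ ¬ (x ↠ c)
    ∉Del⇒↠ x∈X x∉D ¬x↠c = x∉D (x∈X , λ (_ , x↠c) → ¬x↠c x↠c)

    Del∪⊆ : ∀ {c} → c ∈ X → Del X c ∪ ｛ c ｝ ⊆ X
    Del∪⊆ c∈X (inj₁ (x∈X , _)) = x∈X
    Del∪⊆ c∈X (inj₂ refl)      = c∈X

    module _ (acyclic : TwoAcyclic) where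
      open TwoAcyclic acyclic

      -- In a factorization `c ↠ y ↪ z`, the element `y` cannot lie in `Del X c`, so `y ↠ c` and
      -- acyclicity gives `y ≡ c`.
      Del^⊥-⟶⇒↪ : ∀ {c z} → c ∈ X → z ∈ Del X c ^⊥ → c ⟶ z → ¬ ¬ (c ↪ z)
      Del^⊥-⟶⇒↪ c∈X z∈D⊥ c⟶z ¬c↪z =
        let y , c↠y , y↪z = proj₂ mult c⟶z in
        ∉Del⇒↠ (↠-closed c↠y c∈X) (λ y∈D → z∈D⊥ y∈D (↪⇒⟶ y↪z)) λ y↠c →
          ¬c↪z (subst (_↪ _) (↠↠-acyclic y↠c c↠y) y↪z)

      module _ {c} (c∈Cov : c ∈ Cov X) where
        private
          c∈X : c ∈ X
          c∈X = proj₁ c∈Cov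

          Del-closed : Closed (Del X c)
          Del-closed = proj₁ (proj₂ c∈Cov)

        Cov⇒∉closure-Del : c ∉ closure (Del X c)
        Cov⇒∉closure-Del c∈D̄ = proj₂ (proj₁ Del-closed c∈D̄) (c∈X , ↠-refl)

        Cov⇒⟶ : ∀ {b} → b ∈ X → b ∈ Del X c ^⊥ → ¬ ¬ (c ⟶ b)
        Cov⇒⟶ {b} b∈X b∈D⊥ ¬c⟶b =
          proj₂ (proj₂ (proj₂ c∈Cov)) b∈X b∈[D∪c]⊥ ⟶-refl
          where
          b∈[D∪c]⊥ : b ∈ (Del X c ∪ ｛ c ｝) ^⊥
          b∈[D∪c]⊥ (inj₁ d∈D)  = b∈D⊥ d∈D
          b∈[D∪c]⊥ (inj₂ refl) = ¬c⟶b

        Cov⇒C : c ∈ C X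
        Cov⇒C = c∈X , λ (b , (b∈X , c≢b) , b↪c) →
          Cov⇒∉closure-Del λ z∈D⊥ c⟶z →
          Del^⊥-⟶⇒↪ c∈X z∈D⊥ c⟶z λ c↪z →
          let
            b∈D⊥ : b ∈ Del X c ^⊥
            b∈D⊥ d∈D d⟶b = z∈D⊥ d∈D (⟶-↪-trans (⟶-↪-trans d⟶b b↪c) c↪z)
          in
          Cov⇒⟶ b∈X b∈D⊥ λ c⟶b →
          -- The argument used for `z` now applies to `b` and closes the cycle `c ↪ b ↪ c`.
          Del^⊥-⟶⇒↪ c∈X b∈D⊥ c⟶b λ c↪b →
          c≢b (↪↪-acyclic c↪b b↪c)

        Cov⇒Maximal : c ∈ Maximal _↠_ (C X)
        Cov⇒Maximal = Cov⇒C , λ (b , (b∈C , c≢b) , b↠c) →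
          Cov⇒⟶ (proj₁ b∈C) (C⊆Del^⊥ b∈C b↠c) λ c⟶b →
          ⟶C⇒↠ c∈X b∈C c⟶b λ c↠b →
          c≢b (↠↠-acyclic c↠b b↠c)

      C⇒Del-closed : ∀ {c} → c ∈ C X → Closed (Del X c)
      C⇒Del-closed {c} c∈C = closure⊆ , closure-extensive
        where
        closure⊆ : closure (Del X c) ⊆ Del X c
        -- `x ↠ c` would give `x ⟶ c`, although `c` itself lies in `Del X c ^⊥`.
        closure⊆ x∈D̄ = proj₁ X-closed (closure-mono proj₁ x∈D̄) , λ (_ , x↠c) →
          x∈D̄ (C⊆Del^⊥ c∈C ↠-refl) (↠-⟶-trans x↠c ⟶-refl)

      Maximal⇒Cov : ∀ {xs} → X ⊆ (_∈ₗ xs) → Maximal _↠_ (C X) ⊆ Cov X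
      Maximal⇒Cov X⊆xs {c} (c∈C , c-max) =
        c∈X , C⇒Del-closed c∈C ,
        (proj₁ X-closed ∘ closure-mono (Del∪⊆ c∈X)) , X⊆closure
        where
        c∈X = proj₁ c∈C

        X⊆closure : X ⊆ closure (Del X c ∪ ｛ c ｝)
        X⊆closure x∈X z∈[D∪c]⊥ x⟶z =
          let y , x↠y , y↪z = proj₂ mult x⟶z in
          -- Since `m ⟶ z`, the element `m` is neither in `Del X c` nor equal to `c`; it would then
          -- lie strictly `↠`-above `c` in `C X`.
          ∃-maximal ↪-refl ↪-trans ↪↪-acyclic X⊆xs (↠-closed x↠y x∈X)
            λ (m , m∈C , m↪y) →
          let m⟶z = ↪⇒⟶ (↪-trans m↪y y↪z) in
          ∉Del⇒↠ (proj₁ m∈C) (λ m∈D → z∈[D∪c]⊥ (inj₁ m∈D) m⟶z) λ m↠c →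
          c-max (m , (m∈C , λ c≡m → z∈[D∪c]⊥ (inj₂ c≡m) m⟶z) , m↠c)

theorem5p4 : ∀ {a ℓ₁ ℓ₂ ℓ₃ p} (F : FactorizationSystem a ℓ₁ ℓ₂ ℓ₃) →
    let open FactorizationSystem F in
    TwoAcyclic → (X : Pred S p) → Closed X →
    (Cov X ⊆ Maximal _↠_ (C X)) ×
    (Finite {S = S} U ⊎ Finite X → Cov X ≐ Maximal _↠_ (C X))
theorem5p4 F acyclic X X-closed = Cov⊆ , λ finite → Cov⊆ ,
  [ (λ (_ , S⊆xs , _) → Maximal⇒Cov X-closed acyclic λ _ → S⊆xs _)
  , (λ (_ , X⊆xs , _) → Maximal⇒Cov X-closed acyclic X⊆xs)
  ]′ finite
  where
  open FactorizationSystem F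
  open FactorizationSystemProperties F

  Cov⊆ : Cov X ⊆ Maximal _↠_ (C X)
  Cov⊆ = Cov⇒Maximal X-closed acyclic
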